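{- Assume the set of atoms is finite. For every finite set of formulas $\Gamma$ and every formula $A$, there is a finite set $\Pi$ of $\Gamma$-projective formulas such that (1) $\vdash\bigvee\Pi\to A$, and (2) $A\mathrel{|\!\sim_{\Gamma}}\Pi$.
   Context: The language $\mathcal{L}$ is built from atoms ${\sf atom}={\sf var}\cup{\sf par}$ (variables and parameters, disjoint), ${\sf atom}$ finite, using $\bot,\wedge,\vee,\to$; $\bigvee\emptyset:=\bot$. $\mathcal{L}({\sf par})$ is the set of formulas whose atoms are all parameters. A substitution is a map $\theta:\mathcal{L}\to\mathcal{L}$ commuting with connectives with $\theta(p)=p$ for $p\in{\sf par}$. $\vdash$ is intuitionistic derivability. For $E\in\mathcal{L}({\sf par})$, a formula $B$ is $E$-projective if there is $\theta$ with $B\vdash\theta(a)\leftrightarrow a$ for every atom $a$ and $\vdash\theta(B)\leftrightarrow E$; $B$ is $\Gamma$-projective if it is $E$-projective for some $E\in\Gamma\cap\mathcal{L}({\sf par})$. $A\mathrel{|\!\sim_{\Gamma}}\Pi$ means: for every $E\in\Gamma\cap\mathcal{L}({\sf par})$ and every substitution $\theta$ with $\vdash E\to\theta(A)$, there exists $B\in\Pi$ with $\vdash E\to\theta(B)$. -}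

module Defs where

open import Data.Nat using (ℕ)
open import Data.Fin using (Fin)
open import Data.Sum using (_⊎_; inj₁; inj₂)
open import Data.Product using (Σ; _×_; ∃)
open import Data.Unit using (⊤)
open import Data.Empty using (⊥)
open import Data.List using (List; []; _∷_; foldr)
open import Data.List.Membership.Propositional using (_∈_)
open import Data.List.Relation.Unary.All using (All)
open import Data.List.Relation.Unary.Any using (Any)

-- The finite set of atoms: nv variables and np parameters (disjoint).
-- Atom nv np = var ⊎ par.
Atom : ℕ → ℕ → Set
Atom nv np = Fin nv ⊎ Fin np

infixr 6 _∧'_
infixr 5 _∨'_
infixr 4 _⇒_
data Form (nv np : ℕ) : Set where
  var  : Fin nv → Form nv np
  par  : Fin np → Form nv np
  ⊥'   : Form nv np
  _∧'_ : Form nv np → Form nv np → Form nv np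
  _∨'_ : Form nv np → Form nv np → Form nv np
  _⇒_  : Form nv np → Form nv np → Form nv np

module _ {nv np : ℕ} where

  atom : Atom nv np → Form nv np
  atom (inj₁ x) = var x
  atom (inj₂ p) = par p

  infix 3 _⇔_
  _⇔_ : Form nv np → Form nv np → Form nv np
  A ⇔ B = (A ⇒ B) ∧' (B ⇒ A)

  ⋁ : List (Form nv np) → Form nv np
  ⋁ = foldr _∨'_ ⊥'

  IsPar : Form nv np → Set
  IsPar (var _) = ⊥
  IsPar (par _) = ⊤
  IsPar ⊥' = ⊤
  IsPar (A ∧' B) = IsPar A × IsPar B
  IsPar (A ∨' B) = IsPar A × IsPar B
  IsPar (A ⇒ B) = IsPar A × IsPar B

  Subst : Set
  Subst = Fin nv → Form nv np

  sub : Subst → Form nv np → Form nv np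
  sub θ (var x) = θ x
  sub θ (par p) = par p
  sub θ ⊥' = ⊥'
  sub θ (A ∧' B) = sub θ A ∧' sub θ B
  sub θ (A ∨' B) = sub θ A ∨' sub θ B
  sub θ (A ⇒ B) = sub θ A ⇒ sub θ B

  infix 2 _⊢_
  data _⊢_ (Δ : List (Form nv np)) : Form nv np → Set where
    hyp  : ∀ {A} → A ∈ Δ → Δ ⊢ A
    ⊥E   : ∀ {A} → Δ ⊢ ⊥' → Δ ⊢ A
    ∧I   : ∀ {A B} → Δ ⊢ A → Δ ⊢ B → Δ ⊢ A ∧' B
    ∧E₁  : ∀ {A B} → Δ ⊢ A ∧' B → Δ ⊢ A
    ∧E₂  : ∀ {A B} → Δ ⊢ A ∧' B → Δ ⊢ B
    ∨I₁  : ∀ {A B} → Δ ⊢ A → Δ ⊢ A ∨' B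
    ∨I₂  : ∀ {A B} → Δ ⊢ B → Δ ⊢ A ∨' B
    ∨E   : ∀ {A B C} → Δ ⊢ A ∨' B → (A ∷ Δ) ⊢ C → (B ∷ Δ) ⊢ C → Δ ⊢ C
    ⇒I   : ∀ {A B} → (A ∷ Δ) ⊢ B → Δ ⊢ A ⇒ B
    ⇒E   : ∀ {A B} → Δ ⊢ A ⇒ B → Δ ⊢ A → Δ ⊢ B

  infix 2 ⊢_
  ⊢_ : Form nv np → Set
  ⊢ A = [] ⊢ A

  Projective : Form nv np → Form nv np → Set
  Projective E B = Σ Subst λ θ →
    ((a : Atom nv np) → (B ∷ []) ⊢ sub θ (atom a) ⇔ atom a) × (⊢ sub θ B ⇔ E)

  ΓProjective : List (Form nv np) → Form nv np → Set
  ΓProjective Γ B = Σ (Form nv np) λ E → (E ∈ Γ) × IsPar E × Projective E B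

  Entails : List (Form nv np) → Form nv np → List (Form nv np) → Set
  Entails Γ A Π = (E : Form nv np) → E ∈ Γ → IsPar E → (θ : Subst) →
    ⊢ E ⇒ sub θ A → Any (λ B → ⊢ E ⇒ sub θ B) Π

{-# OPTIONS --safe #-}
module Submission where

-- Ghilardi's argument on finite Kripke trees, with the points fixed and the substitutions varying:
-- the type of level n of a point under θ determines which sub θ X with rank X ≤ n it forces.
-- Given τ with ⊢ E ⇒ sub τ A, let n bound the ranks of A and E, and let B say that every type of
-- level n (under the identity) is the type under τ of a point forcing E. Then ⊢ B ⇒ A and
-- ⊢ E ⇒ sub τ B. Call a point good at θ if it forces sub θ B. Joining such witnesses by a root shows
-- that a bad point forcing E whose proper successors are good becomes good after a change of the
-- variables there. Ghilardi's substitutions θ_a^B, for all a ⊆ var, perform these changes, and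
-- boundedly many rounds of them unify B: if a round leaves a point bad without enlarging the set of
-- types of good points above it, then all bad points above it look alike, and they would have become
-- good simultaneously. There are finitely many such B, and whether the resulting substitution
-- unifies B is decidable because derivability is.

open import Defs
open import Data.Bool as Bool using (Bool; true; if_then_else_)
open import Data.Empty using (⊥; ⊥-elim)
open import Data.Fin using (Fin; zero; suc; combine; finToFun; funToFin; splitAt; join)
import Data.Fin.Properties as Fin
open import Data.List
  using (List; []; _∷_; _++_; length; lookup; map; filter; foldr; allFin; cartesianProduct)
open import Data.List.Properties using (length-filter; length-removeAt′)
open import Data.List.Membership.Propositional using (_∈_; lose)
open import Data.List.Membership.Propositional.Properties
  using (∈-++⁺ˡ; ∈-++⁺ʳ; ∈-++⁻; ∈-map⁺; ∈-allFin; ∈-map∘filter⁺; ∈-map∘filter⁻;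
         ∈-cartesianProduct⁺; ∈-cartesianProduct⁻)
open import Data.List.Relation.Binary.Subset.Propositional using (_⊆_)
open import Data.List.Relation.Binary.Subset.Propositional.Properties using (∷⁺ʳ)
open import Data.List.Relation.Unary.All as All using (All; []; _∷_)
open import Data.List.Relation.Unary.Any as Any using (here; there; _─_)
open import Data.List.Relation.Unary.Any.Properties using (lookup-index)
open import Data.Nat
  using (ℕ; zero; suc; _+_; _^_; _⊔_; _≤_; _<_; z≤n; s≤s; s≤s⁻¹; _≤?_; _≤′_; ≤′-refl; ≤′-step)
open import Data.Nat.Properties
  using (≤-trans; ≤-reflexive; ≤-refl; m≤n⇒m≤1+n; ≤⇒≤′; ≤′⇒≤; z≤′n; ≰⇒>; 1+n≰n;
         m⊔n≤o⇒m≤o; m⊔n≤o⇒n≤o; m≤m⊔n; m≤n⊔m)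
open import Data.Product using (Σ; ∃; _×_; _,_; proj₁; proj₂)
open import Data.Sum as Sum using (_⊎_; inj₁; inj₂; [_,_]′)
open import Function using (_∘_; id; case_of_)
open import Relation.Binary.PropositionalEquality
  using (_≡_; _≢_; refl; sym; trans; cong; cong₂; subst)
open import Relation.Nullary using (¬_; Dec; yes; no; does)
open import Relation.Nullary.Decidable
  using (map′; dec-true; ¬?; _×-dec_; _⊎-dec_; _→-dec_; decidable-stable)
open import Relation.Unary using (Decidable)

-- Kripke semantics and completeness

all-or-find : ∀ {A : Set} {P : A → Set} {Q : Set} xs →
  (∀ {x} → x ∈ xs → P x ⊎ Q) → (∀ {x} → x ∈ xs → P x) ⊎ Q
all-or-find []       f = inj₁ λ ()
all-or-find (x ∷ xs) f with f (here refl) | all-or-find xs (f ∘ there)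
... | inj₂ q | _      = inj₂ q
... | inj₁ _ | inj₂ q = inj₂ q
... | inj₁ p | inj₁ g = inj₁ λ { (here refl) → p ; (there i) → g i }

collect : ∀ {A K : Set} {P : A → Set} {R : A → K → Set} xs →
  (∀ {x} → x ∈ xs → P x ⊎ Σ K (R x)) →
  Σ (List K) λ ks → ∀ {x} → x ∈ xs → P x ⊎ (Σ K λ k → k ∈ ks × R x k)
collect []       f = [] , λ ()
collect (x ∷ xs) f with f (here refl) | collect xs (f ∘ there)
... | inj₁ p       | ks , g = ks , λ { (here refl) → inj₁ p ; (there i) → g i }
... | inj₂ (k , r) | ks , g = k ∷ ks , λ
  { (here refl) → inj₂ (k , here refl , r)
  ; (there i) → Sum.map₂ (λ { (k' , i' , r') → k' , there i' , r' }) (g i) }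

module Kripke (nv np : ℕ) where

  Fm : Set
  Fm = Form nv np

  data Tree : Set where
    node : (Atom nv np → Bool) → {k : ℕ} → (Fin k → Tree) → Tree

  val : Tree → Atom nv np → Bool
  val (node v _) = v

  infix 4 _≼_ _⊩_ _⊩*_

  data _≼_ : Tree → Tree → Set where
    root  : ∀ {t} → t ≼ t
    child : ∀ {s v k} {ts : Fin k → Tree} (i : Fin k) → s ≼ ts i → s ≼ node v ts

  ≼-trans : ∀ {r s t} → r ≼ s → s ≼ t → r ≼ t
  ≼-trans r≼s root = r≼s
  ≼-trans r≼s (child i s≼t) = child i (≼-trans r≼s s≼t)

  module _ {P : Tree → Set} (P? : Decidable P) where

    all≼? : ∀ t → Dec (∀ {s} → s ≼ t → P s)
    all≼? t@(node v ts) = map′ to from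
      (P? t ×-dec Fin.all? {P = λ i → ∀ {s} → s ≼ ts i → P s} (λ i → all≼? (ts i)))
      where
      to : P t × (∀ i {s} → s ≼ ts i → P s) → ∀ {s} → s ≼ t → P s
      to (p , _)  root         = p
      to (_ , ps) (child i s≼) = ps i s≼
      from : (∀ {s} → s ≼ t → P s) → P t × (∀ i {s} → s ≼ ts i → P s)
      from ps = ps root , λ i s≼ → ps (child i s≼)

    any≼? : ∀ t → Dec (∃ λ s → s ≼ t × P s)
    any≼? t@(node v ts) =
      map′ (λ { (inj₁ p) → t , root , p ; (inj₂ (i , s , s≼ , p)) → s , child i s≼ , p })
           (λ { (_ , root , p) → inj₁ p ; (s , child i s≼ , p) → inj₂ (i , s , s≼ , p) })
           (P? t ⊎-dec Fin.any? (λ i → any≼? (ts i)))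

  -- Atoms are forced when true on the whole subtree, so valuations need not be monotone.
  _⊩_ : Tree → Fm → Set
  t ⊩ var x    = ∀ {s} → s ≼ t → val s (inj₁ x) ≡ true
  t ⊩ par p    = ∀ {s} → s ≼ t → val s (inj₂ p) ≡ true
  t ⊩ ⊥'       = ⊥
  t ⊩ (A ∧' B) = t ⊩ A × t ⊩ B
  t ⊩ (A ∨' B) = t ⊩ A ⊎ t ⊩ B
  t ⊩ (A ⇒ B)  = ∀ {s} → s ≼ t → s ⊩ A → s ⊩ B

  atom-intro : ∀ a {t} → (∀ {s} → s ≼ t → val s a ≡ true) → t ⊩ atom a
  atom-intro (inj₁ _) f = f
  atom-intro (inj₂ _) f = f

  atom-elim : ∀ a {t} → t ⊩ atom a → ∀ {s} → s ≼ t → val s a ≡ true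
  atom-elim (inj₁ _) f = f
  atom-elim (inj₂ _) f = f

  ⊩-mono : ∀ A {s t} → s ≼ t → t ⊩ A → s ⊩ A
  ⊩-mono (var x)  s≼t f r≼s = f (≼-trans r≼s s≼t)
  ⊩-mono (par p)  s≼t f r≼s = f (≼-trans r≼s s≼t)
  ⊩-mono (A ∧' B) s≼t (a , b) = ⊩-mono A s≼t a , ⊩-mono B s≼t b
  ⊩-mono (A ∨' B) s≼t (inj₁ a) = inj₁ (⊩-mono A s≼t a)
  ⊩-mono (A ∨' B) s≼t (inj₂ b) = inj₂ (⊩-mono B s≼t b)
  ⊩-mono (A ⇒ B)  s≼t f r≼s = f (≼-trans r≼s s≼t)

  _⊩?_ : ∀ t A → Dec (t ⊩ A)
  t ⊩? var x    = all≼? (λ s → val s (inj₁ x) Bool.≟ true) t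
  t ⊩? par p    = all≼? (λ s → val s (inj₂ p) Bool.≟ true) t
  t ⊩? ⊥'       = no id
  t ⊩? (A ∧' B) = t ⊩? A ×-dec t ⊩? B
  t ⊩? (A ∨' B) = t ⊩? A ⊎-dec t ⊩? B
  t ⊩? (A ⇒ B)  = all≼? (λ s → s ⊩? A →-dec s ⊩? B) t

  _⊩*_ : Tree → List Fm → Set
  t ⊩* Δ = ∀ {X} → X ∈ Δ → t ⊩ X

  ⊩*-∷ : ∀ {t X Δ} → t ⊩ X → t ⊩* Δ → t ⊩* (X ∷ Δ)
  ⊩*-∷ x δ (here refl) = x
  ⊩*-∷ x δ (there i)   = δ i

  soundness : ∀ {Δ A t} → Δ ⊢ A → t ⊩* Δ → t ⊩ A
  soundness (hyp i)     δ = δ i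
  soundness (⊥E d)      δ = ⊥-elim (soundness d δ)
  soundness (∧I d e)    δ = soundness d δ , soundness e δ
  soundness (∧E₁ d)     δ = proj₁ (soundness d δ)
  soundness (∧E₂ d)     δ = proj₂ (soundness d δ)
  soundness (∨I₁ d)     δ = inj₁ (soundness d δ)
  soundness (∨I₂ d)     δ = inj₂ (soundness d δ)
  soundness (∨E d e f)  δ with soundness d δ
  ... | inj₁ a = soundness e (⊩*-∷ a δ)
  ... | inj₂ b = soundness f (⊩*-∷ b δ)
  soundness (⇒I d)      δ s≼t a = soundness d (⊩*-∷ a (λ {X} i → ⊩-mono X s≼t (δ i)))
  soundness (⇒E d e)    δ = soundness d δ root (soundness e δ)

  weaken : ∀ {Δ Δ' : List Fm} {A} → Δ ⊆ Δ' → Δ ⊢ A → Δ' ⊢ A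
  weaken σ (hyp i)    = hyp (σ i)
  weaken σ (⊥E d)     = ⊥E (weaken σ d)
  weaken σ (∧I d e)   = ∧I (weaken σ d) (weaken σ e)
  weaken σ (∧E₁ d)    = ∧E₁ (weaken σ d)
  weaken σ (∧E₂ d)    = ∧E₂ (weaken σ d)
  weaken σ (∨I₁ d)    = ∨I₁ (weaken σ d)
  weaken σ (∨I₂ d)    = ∨I₂ (weaken σ d)
  weaken σ (∨E d e f) = ∨E (weaken σ d) (weaken (∷⁺ʳ _ σ) e) (weaken (∷⁺ʳ _ σ) f)
  weaken σ (⇒I d)     = ⇒I (weaken (∷⁺ʳ _ σ) d)
  weaken σ (⇒E d e)   = ⇒E (weaken σ d) (weaken σ e)

  -- Deciding derivability by a search for finite countermodels

  subformulas : Fm → List Fm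
  subformulas X@(A ∧' B) = X ∷ subformulas A ++ subformulas B
  subformulas X@(A ∨' B) = X ∷ subformulas A ++ subformulas B
  subformulas X@(A ⇒ B)  = X ∷ subformulas A ++ subformulas B
  subformulas X          = X ∷ []

  self∈subformulas : ∀ X → X ∈ subformulas X
  self∈subformulas (var x)  = here refl
  self∈subformulas (par p)  = here refl
  self∈subformulas ⊥'       = here refl
  self∈subformulas (A ∧' B) = here refl
  self∈subformulas (A ∨' B) = here refl
  self∈subformulas (A ⇒ B)  = here refl

  subformulas-trans : ∀ Y {X} → X ∈ subformulas Y → subformulas X ⊆ subformulas Y
  subformulas-trans (var _)  (here refl) i = i
  subformulas-trans (par _)  (here refl) i = i
  subformulas-trans ⊥'       (here refl) i = i
  subformulas-trans (A ∧' B) (here refl) i = i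
  subformulas-trans (A ∧' B) (there j) i with ∈-++⁻ (subformulas A) j
  ... | inj₁ j = there (∈-++⁺ˡ (subformulas-trans A j i))
  ... | inj₂ j = there (∈-++⁺ʳ (subformulas A) (subformulas-trans B j i))
  subformulas-trans (A ∨' B) (here refl) i = i
  subformulas-trans (A ∨' B) (there j) i with ∈-++⁻ (subformulas A) j
  ... | inj₁ j = there (∈-++⁺ˡ (subformulas-trans A j i))
  ... | inj₂ j = there (∈-++⁺ʳ (subformulas A) (subformulas-trans B j i))
  subformulas-trans (A ⇒ B) (here refl) i = i
  subformulas-trans (A ⇒ B) (there j) i with ∈-++⁻ (subformulas A) j
  ... | inj₁ j = there (∈-++⁺ˡ (subformulas-trans A j i))
  ... | inj₂ j = there (∈-++⁺ʳ (subformulas A) (subformulas-trans B j i))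

  ≟-atom : ∀ a (X : Fm) → Dec (atom a ≡ X)
  ≟-atom (inj₁ x) (var y)  = map′ (cong var) (λ { refl → refl }) (x Fin.≟ y)
  ≟-atom (inj₁ x) (par _)  = no λ ()
  ≟-atom (inj₁ x) ⊥'       = no λ ()
  ≟-atom (inj₁ x) (_ ∧' _) = no λ ()
  ≟-atom (inj₁ x) (_ ∨' _) = no λ ()
  ≟-atom (inj₁ x) (_ ⇒ _)  = no λ ()
  ≟-atom (inj₂ p) (par q)  = map′ (cong par) (λ { refl → refl }) (p Fin.≟ q)
  ≟-atom (inj₂ p) (var _)  = no λ ()
  ≟-atom (inj₂ p) ⊥'       = no λ ()
  ≟-atom (inj₂ p) (_ ∧' _) = no λ ()
  ≟-atom (inj₂ p) (_ ∨' _) = no λ ()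
  ≟-atom (inj₂ p) (_ ⇒ _)  = no λ ()

  atom∈? : ∀ a (Δ : List Fm) → Dec (atom a ∈ Δ)
  atom∈? a = Any.any? (≟-atom a)

  Countermodel : List Fm → Fm → Set
  Countermodel Δ C = Σ Tree λ t → t ⊩* Δ × ¬ t ⊩ C

  forget : ∀ {X Δ C} → Countermodel (X ∷ Δ) C → Countermodel Δ C
  forget (t , δ , ¬c) = t , (λ i → δ (there i)) , ¬c

  -- One node of the countermodel search over the fragment U. If X , Δ ⊢ C for all X in U ∖ Δ,
  -- then, unless Δ ⊢ C, the set Δ is a prime theory of the fragment, hence the theory of a root.
  module Search (U : List Fm) (closed : ∀ {X} → X ∈ U → subformulas X ⊆ U)
    (Δ Ω : List Fm) (Δ⊆U : Δ ⊆ U) (split : ∀ {X} → X ∈ U → X ∈ Δ ⊎ X ∈ Ω)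
    (extend : ∀ {X} → X ∈ U → X ∈ Ω → ∀ {Y} → Y ∈ U → (X ∷ Δ ⊢ Y) ⊎ Countermodel (X ∷ Δ) Y)
    {C : Fm} (C∈U : C ∈ U) where

    extend′ : ∀ {X} → X ∈ U → ∀ {Y} → Y ∈ U → (X ∈ Δ ⊎ (X ∷ Δ ⊢ Y)) ⊎ Countermodel (X ∷ Δ) Y
    extend′ X∈U Y∈U with split X∈U
    ... | inj₁ X∈Δ = inj₁ (inj₁ X∈Δ)
    ... | inj₂ X∈Ω = Sum.map₁ inj₂ (extend X∈U X∈Ω Y∈U)

    Child : Set
    Child = Σ Tree (_⊩* Δ)

    Separates : Fm × Fm → Child → Set
    Separates (X , Y) (t , _) = t ⊩ X × ¬ t ⊩ Y

    -- A root refuses an implication through a successor that separates its two sides; one is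
    -- collected for every pair of the fragment whose search returned a countermodel.
    children : Σ (List Child) λ ks → ∀ {XY} → XY ∈ cartesianProduct U U →
      (proj₁ XY ∈ Δ ⊎ (proj₁ XY ∷ Δ ⊢ proj₂ XY)) ⊎ (Σ Child λ k → k ∈ ks × Separates XY k)
    children = collect (cartesianProduct U U) λ i →
      let X∈U , Y∈U = ∈-cartesianProduct⁻ U U i in
      Sum.map₂ (λ { (t , δ , ¬y) → (t , λ i → δ (there i)) , δ (here refl) , ¬y }) (extend′ X∈U Y∈U)

    kids : List Child
    kids = proj₁ children

    top : Tree
    top = node (λ a → does (atom∈? a Δ)) (λ i → proj₁ (lookup kids i))

    kid≼top : ∀ {k} → k ∈ kids → proj₁ k ≼ top
    kid≼top k∈ = child (Any.index k∈) (subst (λ k → _ ≼ proj₁ k) (lookup-index k∈) root)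

    kid-forces : ∀ {s} i → s ≼ proj₁ (lookup kids i) → s ⊩* Δ
    kid-forces i s≼ {X} j = ⊩-mono X s≼ (proj₂ (lookup kids i) j)

    module Maximal (maximal : ∀ {X} → X ∈ U → X ∈ Δ ⊎ (X ∷ Δ ⊢ C)) where

      -- The truth lemma, with `Δ ⊢ C` as an escape. That `X` is outside `Δ` is rendered by a
      -- derivation of `C` from `X`, so that any mismatch with forcing can be cut into a derivation
      -- of `C`.
      Agrees : Fm → Set
      Agrees X = (Δ ⊢ C) ⊎ ((X ∈ Δ × top ⊩ X) ⊎ ((X ∷ Δ ⊢ C) × ¬ top ⊩ X))

      cut : ∀ {X Y} → Δ ⊢ X → X ∷ Δ ⊢ Y → Δ ⊢ Y
      cut d e = ⇒E (⇒I e) d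

      agrees-if : ∀ {X} → X ∈ U → (X ∈ Δ → (Δ ⊢ C) ⊎ top ⊩ X) →
        (X ∷ Δ ⊢ C → (Δ ⊢ C) ⊎ (¬ top ⊩ X)) → Agrees X
      agrees-if X∈U f g with maximal X∈U
      ... | inj₁ X∈Δ = Sum.map₂ (λ x → inj₁ (X∈Δ , x)) (f X∈Δ)
      ... | inj₂ d   = Sum.map₂ (λ ¬x → inj₂ (d , ¬x)) (g d)

      truth-atom : ∀ a → atom a ∈ U → Agrees (atom a)
      truth-atom a a∈U = agrees-if a∈U
        (λ a∈Δ → inj₂ (atom-intro a λ
          { root → dec-true (atom∈? a Δ) a∈Δ
          ; (child i s≼) → atom-elim a (kid-forces i root a∈Δ) s≼ }))
        λ d → [ (λ a∈Δ → inj₁ (cut (hyp a∈Δ) d)) , inj₂ ]′ (unforced (atom∈? a Δ) refl)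
        where
        unforced : (q : Dec (atom a ∈ Δ)) → does (atom∈? a Δ) ≡ does q → atom a ∈ Δ ⊎ (¬ top ⊩ atom a)
        unforced (yes a∈Δ) _ = inj₁ a∈Δ
        unforced (no _) e = inj₂ λ a⊩ → case trans (sym e) (atom-elim a a⊩ root) of λ ()

      truth : ∀ X → subformulas X ⊆ U → Agrees X
      truth (var x) sf = truth-atom (inj₁ x) (sf (here refl))
      truth (par p) sf = truth-atom (inj₂ p) (sf (here refl))
      truth ⊥' sf = agrees-if (sf (here refl)) (λ ⊥∈Δ → inj₁ (⊥E (hyp ⊥∈Δ))) (λ _ → inj₂ id)
      truth (A ∧' B) sf with truth A (λ i → sf (there (∈-++⁺ˡ i)))
                           | truth B (λ i → sf (there (∈-++⁺ʳ (subformulas A) i)))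
      ... | inj₁ d | _ = inj₁ d
      ... | inj₂ _ | inj₁ d = inj₁ d
      ... | inj₂ (inj₁ (A∈Δ , a)) | inj₂ (inj₁ (B∈Δ , b)) =
        agrees-if (sf (here refl)) (λ _ → inj₂ (a , b)) (λ d → inj₁ (cut (∧I (hyp A∈Δ) (hyp B∈Δ)) d))
      ... | inj₂ (inj₂ (d , ¬a)) | inj₂ _ =
        agrees-if (sf (here refl)) (λ i → inj₁ (cut (∧E₁ (hyp i)) d)) (λ _ → inj₂ (¬a ∘ proj₁))
      ... | inj₂ (inj₁ _) | inj₂ (inj₂ (d , ¬b)) =
        agrees-if (sf (here refl)) (λ i → inj₁ (cut (∧E₂ (hyp i)) d)) (λ _ → inj₂ (¬b ∘ proj₂))
      truth (A ∨' B) sf with truth A (λ i → sf (there (∈-++⁺ˡ i)))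
                           | truth B (λ i → sf (there (∈-++⁺ʳ (subformulas A) i)))
      ... | inj₁ d | _ = inj₁ d
      ... | inj₂ _ | inj₁ d = inj₁ d
      ... | inj₂ (inj₁ (A∈Δ , a)) | inj₂ _ =
        agrees-if (sf (here refl)) (λ _ → inj₂ (inj₁ a)) (λ d → inj₁ (cut (∨I₁ (hyp A∈Δ)) d))
      ... | inj₂ (inj₂ _) | inj₂ (inj₁ (B∈Δ , b)) =
        agrees-if (sf (here refl)) (λ _ → inj₂ (inj₂ b)) (λ d → inj₁ (cut (∨I₂ (hyp B∈Δ)) d))
      ... | inj₂ (inj₂ (d , ¬a)) | inj₂ (inj₂ (e , ¬b)) =
        agrees-if (sf (here refl)) (λ i → inj₁ (∨E (hyp i) d e)) (λ _ → inj₂ [ ¬a , ¬b ]′)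
      truth (A ⇒ B) sf with truth A (λ i → sf (there (∈-++⁺ˡ i)))
                          | truth B (λ i → sf (there (∈-++⁺ʳ (subformulas A) i)))
      ... | inj₁ d | _ = inj₁ d
      ... | inj₂ _ | inj₁ d = inj₁ d
      ... | inj₂ _ | inj₂ (inj₁ (B∈Δ , b)) =
        agrees-if (sf (here refl)) (λ _ → inj₂ λ s≼ _ → ⊩-mono B s≼ b)
          (λ d → inj₁ (cut (⇒I (hyp (there B∈Δ))) d))
      ... | inj₂ (inj₁ (A∈Δ , a)) | inj₂ (inj₂ (d , ¬b)) =
        agrees-if (sf (here refl)) (λ i → inj₁ (cut (⇒E (hyp i) (hyp A∈Δ)) d))
          (λ _ → inj₂ λ f → ¬b (f root a))
      -- All points of the successors force `Δ`, hence also `A ⇒ B` if it lies in `Δ`. Otherwise a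
      -- successor separating `A` from `B` refutes it, or else a cut derives `C`.
      ... | inj₂ (inj₂ (d , ¬a)) | inj₂ (inj₂ _) =
        agrees-if (sf (here refl))
          (λ i → inj₂ λ { root a → ⊥-elim (¬a a) ; (child j s≼) a → kid-forces j s≼ i root a })
          refute
        where
        refute : (A ⇒ B) ∷ Δ ⊢ C → (Δ ⊢ C) ⊎ (¬ top ⊩ (A ⇒ B))
        refute e with proj₂ children (∈-cartesianProduct⁺
                        (sf (there (∈-++⁺ˡ (self∈subformulas A))))
                        (sf (there (∈-++⁺ʳ (subformulas A) (self∈subformulas B)))))
        ... | inj₁ (inj₁ A∈Δ) = inj₁ (cut (hyp A∈Δ) d)
        ... | inj₁ (inj₂ A⊢B) = inj₁ (cut (⇒I A⊢B) e)
        ... | inj₂ (k , k∈ , a , ¬b) = inj₂ λ f → ¬b (f (kid≼top k∈) a)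

      forced-or-derives : ∀ {X} → X ∈ U → X ∈ Δ → (top ⊩ X) ⊎ (Δ ⊢ C)
      forced-or-derives {X} X∈U X∈Δ with truth X (closed X∈U)
      ... | inj₁ d = inj₂ d
      ... | inj₂ (inj₁ (_ , x)) = inj₁ x
      ... | inj₂ (inj₂ (d , _)) = inj₂ (cut (hyp X∈Δ) d)

      conclude : (Δ ⊢ C) ⊎ Countermodel Δ C
      conclude with truth C (closed C∈U) | all-or-find Δ (λ i → forced-or-derives (Δ⊆U i) i)
      ... | inj₁ d | _ = inj₁ d
      ... | inj₂ _ | inj₂ d = inj₁ d
      ... | inj₂ (inj₁ (C∈Δ , _)) | inj₁ _ = inj₁ (hyp C∈Δ)
      ... | inj₂ (inj₂ (_ , ¬c)) | inj₁ δ = inj₂ (top , δ , ¬c)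

    result : (Δ ⊢ C) ⊎ Countermodel Δ C
    -- A countermodel for an enlarged `Δ` serves `Δ` as well. If none turns up, every formula of the
    -- fragment outside `Δ` derives `C` together with `Δ`.
    result = [ Maximal.conclude , inj₂ ]′
      (all-or-find {P = λ X → X ∈ Δ ⊎ (X ∷ Δ ⊢ C)} U λ X∈U →
        Sum.map₂ forget (extend′ X∈U C∈U))

  ∈-─ : ∀ {X Y : Fm} {Ω} (p : X ∈ Ω) → Y ∈ Ω → Y ≡ X ⊎ Y ∈ (Ω ─ p)
  ∈-─ (here refl) (here refl) = inj₁ refl
  ∈-─ (here refl) (there i)   = inj₂ i
  ∈-─ (there p)   (here refl) = inj₂ (here refl)
  ∈-─ (there p)   (there i)   = Sum.map₂ there (∈-─ p i)

  -- Each extension moves a formula from `Ω` to `Δ`, so the bound `m` on the length of `Ω`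
  -- decreases; once `Ω` is empty there is nothing left to add.
  search : ∀ U → (∀ {X} → X ∈ U → subformulas X ⊆ U) → ∀ m Δ Ω → length Ω ≤ m →
    Δ ⊆ U → (∀ {X} → X ∈ U → X ∈ Δ ⊎ X ∈ Ω) → ∀ {C} → C ∈ U → (Δ ⊢ C) ⊎ Countermodel Δ C
  search U closed zero Δ [] _ Δ⊆U split = Search.result U closed Δ [] Δ⊆U split (λ _ ())
  search U closed (suc m) Δ Ω |Ω|≤ Δ⊆U split = Search.result U closed Δ Ω Δ⊆U split
    λ X∈U p → search U closed m _ (Ω ─ p)
      (s≤s⁻¹ (≤-trans (≤-reflexive (sym (length-removeAt′ Ω (Any.index p)))) |Ω|≤))
      (λ { (here refl) → X∈U ; (there i) → Δ⊆U i })
      λ i → [ inj₁ ∘ there , (λ j → Sum.map₁ here (∈-─ p j)) ]′ (split i)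

  opaque

    -- Both completeness and the decidability of derivability are read off from this alternative.
    decide : ∀ C → (⊢ C) ⊎ (Σ Tree λ t → ¬ t ⊩ C)
    decide C = Sum.map₂ (λ { (t , _ , ¬c) → t , ¬c })
      (search (subformulas C) (subformulas-trans C) _ [] (subformulas C) ≤-refl (λ ()) inj₂
        (self∈subformulas C))

  completeness : ∀ {C} → (∀ t → t ⊩ C) → ⊢ C
  completeness {C} ⊩C = [ id , (λ { (t , ¬c) → ⊥-elim (¬c (⊩C t)) }) ]′ (decide C)

  completeness-⇒ : ∀ {X Y} → (∀ {t} → t ⊩ X → t ⊩ Y) → ⊢ X ⇒ Y
  completeness-⇒ {X} {Y} f = completeness {X ⇒ Y} λ _ _ → f

  ⊢? : ∀ C → Dec (⊢ C)
  ⊢? C = [ yes , (λ { (t , ¬c) → no λ d → ¬c (soundness d λ ()) }) ]′ (decide C)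

-- Types of points

funToFin-cong : ∀ {m n} {f g : Fin m → Fin n} → (∀ i → f i ≡ g i) → funToFin f ≡ funToFin g
funToFin-cong {zero}  e = refl
funToFin-cong {suc m} e = cong₂ combine (e zero) (funToFin-cong (e ∘ suc))

infix 4 _∈ᶜ_ _∈ᶜ?_

-- Subsets of Fin m coded in Fin (2 ^ m); opaque so that m can be inferred.
opaque

  _∈ᶜ_ : ∀ {m} → Fin m → Fin (2 ^ m) → Set
  i ∈ᶜ c = finToFun c i ≡ suc zero

  _∈ᶜ?_ : ∀ {m} (i : Fin m) (c : Fin (2 ^ m)) → Dec (i ∈ᶜ c)
  i ∈ᶜ? c = finToFun c i Fin.≟ suc zero

  bit : Bool → Fin 2
  bit b = if b then suc zero else zero

  code : ∀ {m} {P : Fin m → Set} → Decidable P → Fin (2 ^ m)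
  code P? = funToFin (bit ∘ does ∘ P?)

module _ {m} {P : Fin m → Set} (P? : Decidable P) where

  opaque
    unfolding _∈ᶜ_

    ∈-code⁺ : ∀ {i} → P i → i ∈ᶜ code P?
    ∈-code⁺ {i} p = trans (Fin.finToFun-funToFin _ i) (cong bit (dec-true (P? i) p))

    ∈-code⁻ : ∀ {i} → i ∈ᶜ code P? → P i
    ∈-code⁻ {i} e with P? i | trans (sym (Fin.finToFun-funToFin (bit ∘ does ∘ P?) i)) e
    ... | yes p | _ = p
    ... | no _  | ()

    code-unique : ∀ c → (∀ {i} → P i → i ∈ᶜ c) → (∀ {i} → i ∈ᶜ c → P i) → code P? ≡ c
    code-unique c to from = trans (funToFin-cong agree) (Fin.funToFin-finToFin {m} {2} c)
      where
      agree : ∀ i → bit (does (P? i)) ≡ finToFun c i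
      agree i with P? i
      ... | yes p = sym (to p)
      ... | no ¬p with finToFun c i in e
      ...   | zero     = refl
      ...   | suc zero = ⊥-elim (¬p (from e))

module _ {A : Set} {P Q : A → Set} (P? : Decidable P) (Q? : Decidable Q) (P⊆Q : ∀ {x} → P x → Q x) where

  length-filter-mono : ∀ xs → length (filter P? xs) ≤ length (filter Q? xs)
  length-filter-mono [] = z≤n
  length-filter-mono (x ∷ xs) with P? x | Q? x
  ... | yes p | yes q = s≤s (length-filter-mono xs)
  ... | yes p | no ¬q = ⊥-elim (¬q (P⊆Q p))
  ... | no ¬p | yes q = m≤n⇒m≤1+n (length-filter-mono xs)
  ... | no ¬p | no ¬q = length-filter-mono xs

  -- A finite inclusion without gain in cardinality is an equality. This turns a stagnating `μ` into
  -- equal sets of keys.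
  length-filter-eq : ∀ xs → length (filter Q? xs) ≤ length (filter P? xs) → ∀ {x} → x ∈ xs → Q x → P x
  length-filter-eq (x ∷ xs) le i q with P? x | Q? x | i
  ... | yes p | _     | here refl = p
  ... | no ¬p | no ¬q | here refl = ⊥-elim (¬q q)
  ... | no ¬p | yes _ | _         = ⊥-elim (1+n≰n (≤-trans le (length-filter-mono xs)))
  ... | yes p | yes _ | there j   = length-filter-eq xs (s≤s⁻¹ le) j q
  ... | yes p | no ¬q | there j   = ⊥-elim (¬q (P⊆Q p))
  ... | no ¬p | no ¬q | there j   = length-filter-eq xs le j q

module Types (nv np : ℕ) where

  open Kripke nv np

  Sub : Set
  Sub = Subst {nv} {np}

  at : Fin (nv + np) → Fm
  at i = atom (splitAt nv i)

  numTypes : ℕ → ℕ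
  numTypes zero    = 2 ^ (nv + np)
  numTypes (suc n) = 2 ^ numTypes n

  opaque

    -- Equality of codes at level `n` is bisimilarity up to depth `n`. Coding types by numbers makes
    -- them finitely many by construction, so they can be counted and ranged over by formulas.
    type : Sub → ∀ n → Tree → Fin (numTypes n)
    type θ zero    t = code (λ i → t ⊩? sub θ (at i))
    type θ (suc n) t = code (λ c → any≼? (λ s → type θ n s Fin.≟ c) t)

  Cover : ℕ → Sub → Tree → Sub → Tree → Set
  Cover n θ t θ' t' = ∀ {s} → s ≼ t → ∃ λ s' → s' ≼ t' × type θ n s ≡ type θ' n s'

  SameAtoms : Sub → Tree → Sub → Tree → Set
  SameAtoms θ t θ' t' = ∀ a → t ⊩ sub θ (atom a) → t' ⊩ sub θ' (atom a)

  opaque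
    unfolding type

    at∈type-zero⁺ : ∀ {θ t} i → t ⊩ sub θ (at i) → i ∈ᶜ type θ 0 t
    at∈type-zero⁺ {θ} {t} i = ∈-code⁺ (λ i → t ⊩? sub θ (at i))

    at∈type-zero⁻ : ∀ {θ t} i → i ∈ᶜ type θ 0 t → t ⊩ sub θ (at i)
    at∈type-zero⁻ {θ} {t} i = ∈-code⁻ (λ i → t ⊩? sub θ (at i))

    type-zero-unique : ∀ {θ t} c → (∀ {i} → t ⊩ sub θ (at i) → i ∈ᶜ c) →
      (∀ {i} → i ∈ᶜ c → t ⊩ sub θ (at i)) → type θ 0 t ≡ c
    type-zero-unique {θ} {t} = code-unique (λ i → t ⊩? sub θ (at i))

    ∈type-suc⁺ : ∀ {θ n t s} → s ≼ t → type θ n s ∈ᶜ type θ (suc n) t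
    ∈type-suc⁺ {θ} {n} {t} s≼ = ∈-code⁺ (λ c → any≼? (λ s → type θ n s Fin.≟ c) t) (_ , s≼ , refl)

    ∈type-suc⁻ : ∀ {θ n t} c → c ∈ᶜ type θ (suc n) t → ∃ λ s → s ≼ t × type θ n s ≡ c
    ∈type-suc⁻ {θ} {n} {t} c = ∈-code⁻ (λ c → any≼? (λ s → type θ n s Fin.≟ c) t)

    type-suc-unique : ∀ {θ n t} c → (∀ {s} → s ≼ t → type θ n s ∈ᶜ c) →
      (∀ {d} → d ∈ᶜ c → ∃ λ s → s ≼ t × type θ n s ≡ d) → type θ (suc n) t ≡ c
    type-suc-unique {θ} {n} {t} c f g = code-unique (λ c → any≼? (λ s → type θ n s Fin.≟ c) t) c
      (λ { (s , s≼ , refl) → f s≼ }) g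

  type-zero⁺ : ∀ {θ t θ' t'} → SameAtoms θ t θ' t' → SameAtoms θ' t' θ t → type θ 0 t ≡ type θ' 0 t'
  type-zero⁺ f g = type-zero-unique _
    (λ {i} p → at∈type-zero⁺ i (f (splitAt nv i) p))
    (λ {i} e → g (splitAt nv i) (at∈type-zero⁻ i e))

  type-zero⁻ : ∀ {θ t θ' t'} → type θ 0 t ≡ type θ' 0 t' → SameAtoms θ t θ' t'
  type-zero⁻ {θ} {t} {θ'} {t'} e a p =
    subst (λ b → t' ⊩ sub θ' (atom b)) (Fin.splitAt-join nv np a)
      (at∈type-zero⁻ i (subst (i ∈ᶜ_) e
        (at∈type-zero⁺ i (subst (λ b → t ⊩ sub θ (atom b)) (sym (Fin.splitAt-join nv np a)) p))))
    where
    i : Fin (nv + np)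
    i = join nv np a

  type-suc⁺ : ∀ {n θ t θ' t'} → Cover n θ t θ' t' → Cover n θ' t' θ t →
    type θ (suc n) t ≡ type θ' (suc n) t'
  type-suc⁺ {n} {θ} {t} {θ'} {t'} f g = type-suc-unique _
    (λ s≼ → let s' , s'≼ , e = f s≼ in subst (_∈ᶜ type θ' (suc n) t') (sym e) (∈type-suc⁺ s'≼))
    (λ i → let s' , s'≼ , e' = ∈type-suc⁻ _ i ; s , s≼ , e = g s'≼ in s , s≼ , trans (sym e) e')

  type-suc⁻ : ∀ {n θ t θ' t'} → type θ (suc n) t ≡ type θ' (suc n) t' → Cover n θ t θ' t'
  type-suc⁻ {n} {θ} e {s} s≼ =
    let s' , s'≼ , e' = ∈type-suc⁻ _ (subst (type θ n s ∈ᶜ_) e (∈type-suc⁺ s≼))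
    in s' , s'≼ , sym e'

  type-pred : ∀ n {θ t θ' t'} → type θ (suc n) t ≡ type θ' (suc n) t' → type θ n t ≡ type θ' n t'
  type-pred zero e = type-zero⁺ (atoms e) (atoms (sym e))
    where
    atoms : ∀ {θ t θ' t'} → type θ 1 t ≡ type θ' 1 t' → SameAtoms θ t θ' t'
    atoms {θ} e a p =
      let s , s≼ , e' = type-suc⁻ (sym e) root
      in type-zero⁻ (sym e') a (⊩-mono (sub θ (atom a)) s≼ p)
  type-pred (suc n) e = type-suc⁺ (cover e) (cover (sym e))
    where
    cover : ∀ {θ t θ' t'} → type θ (suc (suc n)) t ≡ type θ' (suc (suc n)) t' → Cover n θ t θ' t'
    cover e s≼ = let s' , s'≼ , e' = type-suc⁻ e s≼ in s' , s'≼ , type-pred n e'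

  type-≤ : ∀ {m n θ t θ' t'} → m ≤′ n → type θ n t ≡ type θ' n t' → type θ m t ≡ type θ' m t'
  type-≤ ≤′-refl     e = e
  type-≤ (≤′-step l) e = type-≤ l (type-pred _ e)

  type-atoms : ∀ n {θ t θ' t'} → type θ n t ≡ type θ' n t' → SameAtoms θ t θ' t'
  type-atoms n e = type-zero⁻ (type-≤ z≤′n e)

  -- Induction on `n`: a proper successor finds its match above the match of the child it lies
  -- above, and the two roots match each other by the statement one level lower.
  type-root : ∀ n {θ θ' v v' k k'} {ts : Fin k → Tree} {ts' : Fin k' → Tree} →
    let t = node v ts ; t' = node v' ts' in
    SameAtoms θ t θ' t' → SameAtoms θ' t' θ t →
    (∀ i → ∃ λ s' → s' ≼ t' × type θ n (ts i) ≡ type θ' n s') →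
    (∀ i → ∃ λ s → s ≼ t × type θ' n (ts' i) ≡ type θ n s) →
    type θ n t ≡ type θ' n t'
  type-root zero    f g _ _ = type-zero⁺ f g
  type-root (suc n) {θ} {θ'} f g p q = type-suc⁺
    (λ { root → _ , root , eq
       ; (child i s≼) → let s' , s'≼ , e = p i ; s'' , s''≼ , e' = type-suc⁻ e s≼
                        in s'' , ≼-trans s''≼ s'≼ , e' })
    (λ { root → _ , root , sym eq
       ; (child i s≼) → let s' , s'≼ , e = q i ; s'' , s''≼ , e' = type-suc⁻ e s≼
                        in s'' , ≼-trans s''≼ s'≼ , e' })
    where
    eq = type-root n f g (λ i → let s' , s'≼ , e = p i in s' , s'≼ , type-pred n e)
                         (λ i → let s' , s'≼ , e = q i in s' , s'≼ , type-pred n e)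

  rank : Fm → ℕ
  rank (var _)  = 0
  rank (par _)  = 0
  rank ⊥'       = 0
  rank (A ∧' B) = rank A ⊔ rank B
  rank (A ∨' B) = rank A ⊔ rank B
  rank (A ⇒ B)  = suc (rank A ⊔ rank B)

  -- Each implication costs one level, spent on matching a point above `t'` with a point above `t`.
  type-forces : ∀ A {n θ t θ' t'} → rank A ≤ n → type θ n t ≡ type θ' n t' → t ⊩ sub θ A → t' ⊩ sub θ' A
  type-forces (var x) _ e = type-atoms _ e (inj₁ x)
  type-forces (par p) _ e = type-atoms _ e (inj₂ p)
  type-forces (A ∧' B) r e (a , b) =
    type-forces A (m⊔n≤o⇒m≤o _ _ r) e a , type-forces B (m⊔n≤o⇒n≤o (rank A) _ r) e b
  type-forces (A ∨' B) r e =
    Sum.map (type-forces A (m⊔n≤o⇒m≤o _ _ r) e) (type-forces B (m⊔n≤o⇒n≤o (rank A) _ r) e)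
  type-forces (A ⇒ B) {suc n} (s≤s r) e f s'≼ a =
    let s , s≼ , e' = type-suc⁻ (sym e) s'≼ in
    type-forces B (m⊔n≤o⇒n≤o (rank A) _ r) (sym e') (f s≼ (type-forces A (m⊔n≤o⇒m≤o _ _ r) e' a))

  -- Formulas that define types

  ⊤' : Fm
  ⊤' = ⊥' ⇒ ⊥'

  ⋀ : List Fm → Fm
  ⋀ = foldr _∧'_ ⊤'

  select : ∀ {m} {P : Fin m → Set} → Decidable P → (Fin m → Fm) → List Fm
  select P? F = map F (filter P? (allFin _))

  module _ {θ : Sub} {t : Tree} {m} {P : Fin m → Set} (P? : Decidable P) (F : Fin m → Fm) where

    ⋀⁺ : (∀ {i} → P i → t ⊩ sub θ (F i)) → t ⊩ sub θ (⋀ (select P? F))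
    ⋀⁺ f = go (select P? F) λ j →
      case ∈-map∘filter⁻ F P? {f = F} {xs = allFin m} j of λ { (i , _ , refl , p) → f p }
      where
      go : ∀ L → (∀ {X} → X ∈ L → t ⊩ sub θ X) → t ⊩ sub θ (⋀ L)
      go []      f = λ _ → id
      go (X ∷ L) f = f (here refl) , go L (λ i → f (there i))

    ⋀⁻ : t ⊩ sub θ (⋀ (select P? F)) → ∀ {i} → P i → t ⊩ sub θ (F i)
    ⋀⁻ l {i} p = go l (∈-map∘filter⁺ F P? {f = F} {xs = allFin m} (i , ∈-allFin i , refl , p))
      where
      go : ∀ {L X} → t ⊩ sub θ (⋀ L) → X ∈ L → t ⊩ sub θ X
      go (x , _) (here refl) = x
      go (_ , l) (there i)   = go l i

    ⋁⁺ : ∀ {i} → P i → t ⊩ sub θ (F i) → t ⊩ sub θ (⋁ (select P? F))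
    ⋁⁺ {i} p x = go (∈-map∘filter⁺ F P? {f = F} {xs = allFin m} (i , ∈-allFin i , refl , p))
      where
      go : ∀ {L} → F i ∈ L → t ⊩ sub θ (⋁ L)
      go (here refl) = inj₁ x
      go (there i)   = inj₂ (go i)

    ⋁⁻ : t ⊩ sub θ (⋁ (select P? F)) → ∃ λ i → P i × t ⊩ sub θ (F i)
    ⋁⁻ l =
      let X , j , x     = go (select P? F) l
          i , _ , e , p = ∈-map∘filter⁻ F P? {f = F} {xs = allFin m} j
      in i , p , subst (λ Y → t ⊩ sub θ Y) e x
      where
      go : ∀ L → t ⊩ sub θ (⋁ L) → ∃ λ X → X ∈ L × t ⊩ sub θ X
      go (X ∷ L) (inj₁ x) = X , here refl , x
      go (X ∷ L) (inj₂ l) = let Y , i , y = go L l in Y , there i , y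

  without? : ∀ n (c : Fin (numTypes (suc n))) d → Decidable {A = Fin (numTypes n)} (λ e → e ∈ᶜ c × e ≢ d)
  without? n c d e = e ∈ᶜ? c ×-dec ¬? (e Fin.≟ d)

  -- A point has type c iff it forces pos n c and does not force neg n c (Jankov-de Jongh);
  -- within n P? is forced where every point above has its type in P.
  pos neg : ∀ n → Fin (numTypes n) → Fm
  within : ∀ n {P : Fin (numTypes n) → Set} → Decidable P → Fm
  pos zero    c = ⋀ (select (_∈ᶜ? c) at)
  pos (suc n) c = within n (_∈ᶜ? c)
  neg zero    c = ⋁ (select (λ i → ¬? (i ∈ᶜ? c)) at)
  neg (suc n) c = ⋁ (select (_∈ᶜ? c) (λ d → within n (without? n c d)))
  within n P? = ⋀ (select (¬? ∘ P?) (λ c → pos n c ⇒ neg n c))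

  pos-type : ∀ n {θ t} → t ⊩ sub θ (pos n (type θ n t))
  neg-type : ∀ n {θ t} → ¬ t ⊩ sub θ (neg n (type θ n t))
  type-unique : ∀ n {θ t c} → t ⊩ sub θ (pos n c) → ¬ t ⊩ sub θ (neg n c) → type θ n t ≡ c
  within⁺ : ∀ n {P : Fin (numTypes n) → Set} (P? : Decidable P) {θ t} →
    (∀ {s} → s ≼ t → P (type θ n s)) → t ⊩ sub θ (within n P?)
  within⁻ : ∀ n {P : Fin (numTypes n) → Set} (P? : Decidable P) {θ t} →
    t ⊩ sub θ (within n P?) → ∀ {s} → s ≼ t → P (type θ n s)

  pos-type zero {θ} {t} = ⋀⁺ {θ} (_∈ᶜ? type θ 0 t) at λ {i} → at∈type-zero⁻ i
  pos-type (suc n) {θ} {t} = within⁺ n (_∈ᶜ? type θ (suc n) t) ∈type-suc⁺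

  neg-type zero {θ} {t} l =
    let i , i∉ , x = ⋁⁻ {θ} (λ i → ¬? (i ∈ᶜ? type θ 0 t)) at l in i∉ (at∈type-zero⁺ i x)
  neg-type (suc n) {θ} {t} l =
    let d , d∈ , x   = ⋁⁻ {θ} (_∈ᶜ? type θ (suc n) t) (λ d → within n (without? n (type θ (suc n) t) d)) l
        s , s≼t , e = ∈type-suc⁻ d d∈
    in proj₂ (within⁻ n (without? n (type θ (suc n) t) d) x s≼t) e

  type-unique zero {θ} {t} {c} p ¬n = type-zero-unique c
    (λ {i} x → decidable-stable (i ∈ᶜ? c) λ i∉ → ¬n (⋁⁺ {θ} (λ i → ¬? (i ∈ᶜ? c)) at i∉ x))
    (⋀⁻ {θ} (_∈ᶜ? c) at p)
  type-unique (suc n) {θ} {t} {c} p ¬n = type-suc-unique c (within⁻ n (_∈ᶜ? c) p) λ {d} d∈ →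
    -- If no point above `t` had type `d`, then `t` would force the disjunct of `neg (suc n) c` that
    -- belongs to `d`.
    decidable-stable (any≼? (λ s → type θ n s Fin.≟ d) t) λ ¬d →
      ¬n (⋁⁺ {θ} (_∈ᶜ? c) (λ d → within n (without? n c d)) d∈ (within⁺ n (without? n c d)
        λ {s} s≼ → within⁻ n (_∈ᶜ? c) p s≼ , λ e → ¬d (s , s≼ , e)))

  -- A point `s` that forces `pos n c` but not `neg n c` would have type `c`, which is outside `P`.
  within⁺ n {P} P? {θ} {t} f = ⋀⁺ {θ} (¬? ∘ P?) (λ c → pos n c ⇒ neg n c) λ {c} ¬p {s} s≼ x →
    decidable-stable (s ⊩? sub θ (neg n c)) λ ¬n → ¬p (subst P (type-unique n x ¬n) (f s≼))

  within⁻ n P? {θ} {t} l {s} s≼ = decidable-stable (P? (type θ n s)) λ ¬p →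
    neg-type n (⋀⁻ {θ} (¬? ∘ P?) (λ c → pos n c ⇒ neg n c) l ¬p s≼ (pos-type n))

-- Projectivity

module Projectivity (nv np : ℕ) where
  open Kripke nv np
  open Types nv np

  sub-var : ∀ (A : Fm) → sub var A ≡ A
  sub-var (var x)  = refl
  sub-var (par p)  = refl
  sub-var ⊥'       = refl
  sub-var (A ∧' B) = cong₂ _∧'_ (sub-var A) (sub-var B)
  sub-var (A ∨' B) = cong₂ _∨'_ (sub-var A) (sub-var B)
  sub-var (A ⇒ B)  = cong₂ _⇒_ (sub-var A) (sub-var B)

  sub-par : ∀ {θ : Sub} (A : Fm) → IsPar A → sub θ A ≡ A
  sub-par (par p)  _       = refl
  sub-par ⊥'       _       = refl
  sub-par (A ∧' B) (a , b) = cong₂ _∧'_ (sub-par A a) (sub-par B b)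
  sub-par (A ∨' B) (a , b) = cong₂ _∨'_ (sub-par A a) (sub-par B b)
  sub-par (A ⇒ B)  (a , b) = cong₂ _⇒_ (sub-par A a) (sub-par B b)

  isPar? : ∀ (A : Fm) → Dec (IsPar A)
  isPar? (var _)  = no id
  isPar? (par _)  = yes _
  isPar? ⊥'       = yes _
  isPar? (A ∧' B) = isPar? A ×-dec isPar? B
  isPar? (A ∨' B) = isPar? A ×-dec isPar? B
  isPar? (A ⇒ B)  = isPar? A ×-dec isPar? B

  -- Iterating Ghilardi's substitutions

  module Iterate (n : ℕ) {P : Fin (numTypes n) → Set} (P? : Decidable P) where

    B : Fm
    B = within n P?

    Good : Sub → Tree → Set
    Good θ t = t ⊩ sub θ B

    good? : ∀ θ t → Dec (Good θ t)
    good? θ t = t ⊩? sub θ B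

    good-mono : ∀ {θ s t} → s ≼ t → Good θ t → Good θ s
    good-mono {θ} = ⊩-mono (sub θ B)

    -- Ghilardi's substitution θ_a^B: it leaves points forcing B alone and gives the variables
    -- in a, as far as persistence allows, to all the others.
    step : Fin (2 ^ nv) → Sub → Sub
    step a θ x = if does (x ∈ᶜ? a) then sub θ B ⇒ θ x else sub θ B ∧' θ x

    step-in : ∀ {a x} θ → x ∈ᶜ a → step a θ x ≡ (sub θ B ⇒ θ x)
    step-in {a} {x} θ i = cong (if_then sub θ B ⇒ θ x else sub θ B ∧' θ x) (dec-true (x ∈ᶜ? a) i)

    step-in⁺ : ∀ {a x} θ {t} → x ∈ᶜ a → (∀ {s} → s ≼ t → Good θ s → s ⊩ θ x) → t ⊩ step a θ x
    step-in⁺ θ {t} i f = subst (t ⊩_) (sym (step-in θ i)) f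

    step-bad⁻ : ∀ {a x} θ {t} → ¬ Good θ t → t ⊩ step a θ x →
      x ∈ᶜ a × (∀ {s} → s ≼ t → Good θ s → s ⊩ θ x)
    step-bad⁻ {a} {x} θ {t} ¬g h with x ∈ᶜ? a
    ... | yes i = i , h
    ... | no _  = ⊥-elim (¬g (proj₁ h))

    infix 4 _⊑_

    -- Good points are frozen: passing to `θ'` leaves their types alone at every level, so in
    -- particular they stay good.
    _⊑_ : Sub → Sub → Set
    θ ⊑ θ' = ∀ {t} → Good θ t → ∀ k → type θ k t ≡ type θ' k t

    ⊑-good : ∀ {θ θ' t} → θ ⊑ θ' → Good θ t → Good θ' t
    ⊑-good {θ} {θ'} θ⊑θ' g = within⁺ n P? λ s≼ →
      subst P (θ⊑θ' (good-mono {θ} s≼ g) n) (within⁻ n P? g s≼)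

    ⊑-refl : ∀ {θ} → θ ⊑ θ
    ⊑-refl _ _ = refl

    ⊑-trans : ∀ {θ₁ θ₂ θ₃} → θ₁ ⊑ θ₂ → θ₂ ⊑ θ₃ → θ₁ ⊑ θ₃
    ⊑-trans p q g k = trans (p g k) (q (⊑-good p g) k)

    -- Where `sub θ B` is forced, both `sub θ B ⇒ θ x` and `sub θ B ∧' θ x` amount to `θ x`. Good
    -- points are closed upwards, so each point above can be matched with itself.
    ⊑-step : ∀ a θ → θ ⊑ step a θ
    ⊑-step a θ g zero = type-zero⁺
      (λ { (inj₁ x) → to x g ; (inj₂ p) → id }) (λ { (inj₁ x) → from x g ; (inj₂ p) → id })
      where
      to : ∀ x {t} → Good θ t → t ⊩ θ x → t ⊩ step a θ x
      to x g h with x ∈ᶜ? a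
      ... | yes _ = λ s≼ _ → ⊩-mono (θ x) s≼ h
      ... | no _  = g , h
      from : ∀ x {t} → Good θ t → t ⊩ step a θ x → t ⊩ θ x
      from x g h with x ∈ᶜ? a
      ... | yes _ = h root g
      ... | no _  = proj₂ h
    ⊑-step a θ g (suc k) = type-suc⁺
      (λ s≼ → _ , s≼ , ⊑-step a θ (good-mono {θ} s≼ g) k)
      (λ s≼ → _ , s≼ , sym (⊑-step a θ (good-mono {θ} s≼ g) k))

    run : List (Fin (2 ^ nv)) → Sub → Sub
    run []       θ = θ
    run (a ∷ as) θ = run as (step a θ)

    ⊑-run : ∀ as θ → θ ⊑ run as θ
    ⊑-run []       θ = ⊑-refl
    ⊑-run (a ∷ as) θ = ⊑-trans (⊑-step a θ) (⊑-run as (step a θ))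

    Key : Set
    Key = Fin (numTypes n) ⊎ Fin np

    keys : List Key
    keys = map inj₁ (allFin (numTypes n)) ++ map inj₂ (allFin np)

    ∈-keys : ∀ k → k ∈ keys
    ∈-keys (inj₁ c) = ∈-++⁺ˡ (∈-map⁺ inj₁ (∈-allFin c))
    ∈-keys (inj₂ p) = ∈-++⁺ʳ (map inj₁ (allFin (numTypes n))) (∈-map⁺ inj₂ (∈-allFin p))

    -- A parameter counts when it is not forced, so that keys of both kinds persist towards the root
    -- and under later substitutions.
    Seen : Sub → Tree → Key → Set
    Seen θ t (inj₁ c) = ∃ λ s → s ≼ t × Good θ s × type θ n s ≡ c
    Seen θ t (inj₂ p) = ¬ t ⊩ par p

    seen? : ∀ θ t → Decidable (Seen θ t)
    seen? θ t (inj₁ c) = any≼? (λ s → good? θ s ×-dec type θ n s Fin.≟ c) t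
    seen? θ t (inj₂ p) = ¬? (t ⊩? par p)

    seen-mono : ∀ {θ s t k} → s ≼ t → Seen θ s k → Seen θ t k
    seen-mono {k = inj₁ c} s≼ (r , r≼ , g , e) = r , ≼-trans r≼ s≼ , g , e
    seen-mono {k = inj₂ p} s≼ ¬p = λ h → ¬p (⊩-mono (par p) s≼ h)

    seen-⊑ : ∀ {θ θ' t k} → θ ⊑ θ' → Seen θ t k → Seen θ' t k
    seen-⊑ {k = inj₁ c} le (r , r≼ , g , e) = r , r≼ , ⊑-good le g , trans (sym (le g n)) e
    seen-⊑ {k = inj₂ p} le ¬p = ¬p

    -- The potential of the argument: a round of steps raises its minimum over the bad points.
    -- Counting the unforced parameters ensures that bad points of equal μ above one another agree
    -- on the parameters, which no step can change.
    μ : Sub → Tree → ℕ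
    μ θ t = length (filter (seen? θ t) keys)

    μ-⊑ : ∀ {θ θ' t} → θ ⊑ θ' → μ θ t ≤ μ θ' t
    μ-⊑ {θ} {θ'} {t} le =
      length-filter-mono (seen? θ t) (seen? θ' t) (λ {k} → seen-⊑ {k = k} le) keys

    module Uniform (a : Fin (2 ^ nv)) (θ : Sub) (t : Tree)
      (uniform : ∀ {s} → s ≼ t → ¬ Good θ s → ∀ k → Seen θ t k → Seen θ s k) where

      θ' : Sub
      θ' = step a θ

      transfer : ∀ {s s'} → s ≼ t → s' ≼ t → ¬ Good θ s' → ∀ k → Seen θ s k → Seen θ s' k
      transfer s≼ s'≼ ¬g' k seen = uniform s'≼ ¬g' k (seen-mono {k = k} s≼ seen)

      -- After the step, a point that was bad forces a variable of `a` exactly when all good points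
      -- above it did, and no other variable. The types of these good points are among the keys,
      -- which agree at `s` and `s'`.
      same-atoms : ∀ {s s'} → s ≼ t → s' ≼ t → ¬ Good θ s → ¬ Good θ s' → SameAtoms θ' s θ' s'
      same-atoms {s} {s'} s≼ s'≼ ¬g ¬g' (inj₁ x) h =
        let i , f = step-bad⁻ θ ¬g h in
        step-in⁺ θ i λ {r} r≼ gr →
          let q , q≼ , gq , e = transfer s'≼ s≼ ¬g (inj₁ (type θ n r)) (r , r≼ , gr , refl)
          in type-atoms n e (inj₁ x) (f q≼ gq)
      same-atoms {s} {s'} s≼ s'≼ ¬g ¬g' (inj₂ p) h =
        decidable-stable (s' ⊩? par p) λ ¬h → transfer s'≼ s≼ ¬g (inj₂ p) ¬h h

      same-type : ∀ {k} → k ≤′ n → ∀ {s s'} → s ≼ t → s' ≼ t → ¬ Good θ s → ¬ Good θ s' →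
        type θ' k s ≡ type θ' k s'
      -- A bad point above `s` is matched with `s'` itself, a good one with a good point above `s'`
      -- of the same type. Keys record types of level `n`, which is why `k` may not exceed it.
      cover : ∀ {k} → suc k ≤′ n → ∀ {s s'} → s ≼ t → s' ≼ t → ¬ Good θ s → ¬ Good θ s' →
        Cover k θ' s θ' s'

      same-type {zero}  _ s≼ s'≼ ¬g ¬g' =
        type-zero⁺ (same-atoms s≼ s'≼ ¬g ¬g') (same-atoms s'≼ s≼ ¬g' ¬g)
      same-type {suc k} l s≼ s'≼ ¬g ¬g' =
        type-suc⁺ (cover l s≼ s'≼ ¬g ¬g') (cover l s'≼ s≼ ¬g' ¬g)

      cover {k} l {s} {s'} s≼ s'≼ ¬g ¬g' {r} r≼ = case good? θ r of λ
        { (no ¬gr) → s' , root , same-type k≤n (≼-trans r≼ s≼) s'≼ ¬gr ¬g'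
        ; (yes gr) →
            let q , q≼ , gq , e = transfer s≼ s'≼ ¬g' (inj₁ (type θ n r)) (r , r≼ , gr , refl)
            in q , q≼ , trans (sym (⊑-step a θ gr k))
                          (trans (type-≤ k≤n (sym e)) (⊑-step a θ gq k)) }
        where
        k≤n : k ≤′ n
        k≤n = ≤⇒≤′ (≤-trans (m≤n⇒m≤1+n ≤-refl) (≤′⇒≤ l))

      -- The points above `t` that were bad all acquire the type of `u`, which lies in `P`; the
      -- others are frozen.
      all-good : ∀ {u} → u ≼ t → ¬ Good θ u → Good θ' u → Good θ' t
      all-good {u} u≼ ¬gu gu = within⁺ n P? λ {s} s≼ → case good? θ s of λ
        { (yes gs) → within⁻ n P? (⊑-good (⊑-step a θ) gs) root
        ; (no ¬gs) → subst P (same-type ≤′-refl u≼ s≼ ¬gu ¬gs) (within⁻ n P? gu root) }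

    -- Later substitutions are included because a round may take other steps before it comes to `a`.
    Repairs : Sub → Tree → Fin (2 ^ nv) → Set
    Repairs θ u a = ∀ {θ'} → θ ⊑ θ' → ¬ Good θ' u → Good (step a θ') u

    BadAbove : ℕ → Sub → Tree → Set
    BadAbove r θ t = ∀ {s} → s ≼ t → ¬ Good θ s → r ≤ μ θ s

    BadAbove-⊑ : ∀ {r θ θ' t} → θ ⊑ θ' → BadAbove r θ t → BadAbove r θ' t
    BadAbove-⊑ {θ = θ} le b s≼ ¬g = ≤-trans (b s≼ (λ g → ¬g (⊑-good le g))) (μ-⊑ le)

    -- As long as no step lifts `μ` at `t` above `r`, the point `u` stays bad: by uniformity, a
    -- repaired `u` would take `t` along, but `t` is bad at the end. Since the step for `a` would
    -- repair `u`, the lift comes by then.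
    run-increases : ∀ {r t u a} as θ → BadAbove r θ t → u ≼ t → ¬ Good θ u → a ∈ as →
      Repairs θ u a → ¬ Good (run as θ) t → r < μ (run as θ) t
    run-increases {r} {t} {u} (b ∷ bs) θ bad u≼ ¬gu a∈ repairs ¬g with suc r ≤? μ (step b θ) t
    ... | yes r<μ = ≤-trans r<μ (μ-⊑ (⊑-run bs (step b θ)))
    ... | no ¬r<μ = case good? θ' u of λ
      { (yes gu) → ⊥-elim (¬g' (all-good u≼ ¬gu gu)) ; (no ¬gu') → continue a∈ repairs ¬gu' }
      where
      θ' : Sub
      θ' = step b θ
      ¬g' : ¬ Good θ' t
      ¬g' g = ¬g (⊑-good (⊑-run bs θ') g)
      -- μ does not change at t, so all bad points of t have seen the same.
      open Uniform b θ t (λ {s} s≼ ¬gs k → length-filter-eq (seen? θ s) (seen? θ t)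
        (λ {k} → seen-mono {k = k} s≼) keys
        (≤-trans (μ-⊑ (⊑-step b θ)) (≤-trans (s≤s⁻¹ (≰⇒> ¬r<μ)) (bad s≼ ¬gs))) (∈-keys k))
        using (all-good)
      continue : ∀ {a} → a ∈ (b ∷ bs) → Repairs θ u a → ¬ Good θ' u → r < μ (run bs θ') t
      continue (here refl) repairs ¬gu' = ⊥-elim (¬gu' (repairs ⊑-refl ¬gu))
      continue (there a∈)  repairs ¬gu' = run-increases bs θ' (BadAbove-⊑ (⊑-step b θ) bad) u≼ ¬gu' a∈
        (λ le → repairs (⊑-trans (⊑-step b θ) le)) ¬g

    Frontier : Sub → Tree → Set
    Frontier θ u@(node v ts) = ¬ Good θ u × (∀ i → Good θ (ts i))

    frontier-bad : ∀ {θ} u → Frontier θ u → ¬ Good θ u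
    frontier-bad (node v ts) = proj₁

    frontier : ∀ θ t → ¬ Good θ t → ∃ λ u → u ≼ t × Frontier θ u
    frontier θ t@(node v ts) ¬g with Fin.all? (λ i → good? θ (ts i))
    ... | yes gs = t , root , ¬g , gs
    ... | no ¬gs with Fin.¬∀⟶∃¬ _ _ (λ i → good? θ (ts i)) ¬gs
    ...   | i , ¬gi with frontier θ (ts i) ¬gi
    ...     | u , u≼ , f = u , child i u≼ , f

    -- Going through all sets of variables, a round contains whichever step repairs a given frontier
    -- point. Hence `unifier` depends on `B` alone.
    round : Sub → Sub
    round = run (allFin (2 ^ nv))

    ⊑-round : ∀ θ → θ ⊑ round θ
    ⊑-round = ⊑-run (allFin (2 ^ nv))

    rounds : ℕ → Sub
    rounds zero    = var
    rounds (suc r) = round (rounds r)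

    ⊑-rounds : ∀ r → var ⊑ rounds r
    ⊑-rounds zero    = ⊑-refl
    ⊑-rounds (suc r) = ⊑-trans (⊑-rounds r) (⊑-round (rounds r))

    -- One more than `μ` can ever reach.
    bound : ℕ
    bound = suc (length keys)

    unifier : Sub
    unifier = rounds bound

    -- A point forcing `B` is good at the identity substitution, hence frozen through all rounds.
    unifier-fixes : ∀ a → B ∷ [] ⊢ sub unifier (atom a) ⇔ atom a
    unifier-fixes a = ∧I
      (⇒I (from-semantics λ g → subst (_ ⊩_) (sub-var (atom a)) ∘ type-atoms n (sym (same g)) a))
      (⇒I (from-semantics λ g → type-atoms n (same g) a ∘ subst (_ ⊩_) (sym (sub-var (atom a)))))
      where
      same : ∀ {t} → t ⊩ B → type var n t ≡ type unifier n t
      same {t} g = ⊑-rounds bound (subst (t ⊩_) (sym (sub-var B)) g) n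
      from-semantics : ∀ {X Y} → (∀ {t} → t ⊩ B → t ⊩ X → t ⊩ Y) → X ∷ B ∷ [] ⊢ Y
      from-semantics {X} {Y} f = ⇒E (⇒E (weaken (λ ()) (completeness {B ⇒ X ⇒ Y} λ _ _ g s≼ →
        f (⊩-mono B s≼ g))) (hyp (there (here refl)))) (hyp (here refl))

    module Extension (E : Fm)
      (extension : ∀ {θ} u → u ⊩ E → Frontier θ u → ∃ (Repairs θ u)) where

      -- A point `s` bad after a round was bad before it, so it had a frontier point above it, which
      -- some step of the round repairs; `run-increases` then applies with `s` in the place of `t`.
      BadAbove-rounds : ∀ r {t} → t ⊩ E → BadAbove r (rounds r) t
      BadAbove-rounds zero    _ _ _ = z≤n
      BadAbove-rounds (suc r) e {s} s≼ ¬g =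
        let θ = rounds r
            es = ⊩-mono E s≼ e
            u , u≼ , fr = frontier θ s (λ g → ¬g (⊑-good (⊑-round θ) g))
            a , repairs = extension u (⊩-mono E u≼ es) fr
        in run-increases (allFin (2 ^ nv)) θ (BadAbove-rounds r es) u≼ (frontier-bad u fr) (∈-allFin a)
             repairs ¬g

      unifier-good : ∀ {t} → t ⊩ E → Good unifier t
      unifier-good {t} e = decidable-stable (good? unifier t) λ ¬g →
        1+n≰n (≤-trans (BadAbove-rounds bound e root ¬g) (length-filter (seen? unifier t) keys))

  -- The approximation of `A` obtained from a given `τ`

  module Approximation (E : Fm) (E-par : IsPar E) (A : Fm) (τ : Sub) (E⊢τA : ⊢ E ⇒ sub τ A)
    (n : ℕ) (rank-E : rank E ≤ n) (rank-A : rank A ≤ n) where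

    misses : Fin (numTypes n) → Fm
    misses c = within n (λ d → ¬? (d Fin.≟ c))

    -- Being the type under `τ` of a point forcing `E`, put as an underivability to make it
    -- decidable.
    Realised : Fin (numTypes n) → Set
    Realised c = ¬ (⊢ E ⇒ sub τ (misses c))

    realised? : Decidable Realised
    realised? c = ¬? (⊢? (E ⇒ sub τ (misses c)))

    realised⁺ : ∀ {t} → t ⊩ E → Realised (type τ n t)
    realised⁺ {t} e d =
      within⁻ n (λ d → ¬? (d Fin.≟ type τ n t)) {τ} (soundness {t = t} d (λ ()) root e) root refl

    -- The countermodel contains the required point: otherwise all its points forcing `E` would
    -- force `sub τ (misses c)`.
    realised⁻ : ∀ {c} → Realised c → ∃ λ t → t ⊩ E × type τ n t ≡ c
    realised⁻ {c} ¬d with decide (E ⇒ sub τ (misses c))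
    ... | inj₁ d = ⊥-elim (¬d d)
    ... | inj₂ (t , ¬f) with any≼? (λ s → s ⊩? E ×-dec type τ n s Fin.≟ c) t
    ...   | yes (s , _ , e , eq) = s , e , eq
    ...   | no ¬s = ⊥-elim (¬f λ s≼ e → within⁺ n (λ d → ¬? (d Fin.≟ c)) {τ}
                      λ r≼ eq → ¬s (_ , ≼-trans r≼ s≼ , ⊩-mono E r≼ e , eq))

    family : Fin (numTypes (suc n))
    family = code realised?

    open Iterate n (_∈ᶜ? family)

    realise : ∀ {θ t} → Good θ t → ∃ λ s → s ⊩ E × type θ n t ≡ type τ n s
    realise {θ} g =
      let s , e , eq = realised⁻ (∈-code⁻ realised? (within⁻ n (_∈ᶜ? family) {θ} g root)) in
      s , e , sym eq

    -- Substitutions fix `E`, and its rank is within the level compared.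
    transfer-E : ∀ {θ θ' t t'} → type θ n t ≡ type θ' n t' → t ⊩ E → t' ⊩ E
    transfer-E {θ} {θ'} {t} {t'} eq e = subst (t' ⊩_) (sub-par E E-par)
      (type-forces E rank-E eq (subst (t ⊩_) (sym (sub-par E E-par)) e))

    good⇒E : ∀ {θ t} → Good θ t → t ⊩ E
    good⇒E {θ} g = let s , e , eq = realise {θ} g in transfer-E (sym eq) e

    good⇒A : ∀ {t} → Good var t → t ⊩ A
    good⇒A {t} g = let s , e , eq = realise {var} g in
      subst (t ⊩_) (sub-var A) (type-forces A rank-A (sym eq) (soundness {t = s} E⊢τA (λ ()) root e))

    -- Each child of `u` has the type under `τ` of some point forcing `E`. Joining those points by a
    -- root `m` gives a model of `τ` that `u` can imitate: `a` consists of the variables whose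
    -- images under `τ` hold at `m`.
    extension : ∀ {θ} u → u ⊩ E → Frontier θ u → ∃ (Repairs θ u)
    extension {θ} u@(node v ts) e (_ , gs) = a , repairs
      where
      ms : ∀ i → Tree
      ms i = proj₁ (realise {θ} (gs i))
      m : Tree
      -- Keeping the valuation of `u` makes the parameters agree at the two roots.
      m = node v ms
      a : Fin (2 ^ nv)
      a = code (λ x → m ⊩? τ x)
      repairs : Repairs θ u a
      repairs {θ'} le ¬g = within⁺ n (_∈ᶜ? family) {step a θ'} λ
        -- `E` passes from `u` to `m` by equality of types, so `m` itself realises the new type of
        -- `u`.
        { root → subst (_∈ᶜ family) (sym same) (∈-code⁺ realised? (realised⁺ (transfer-E same e)))
        ; (child i s≼) → within⁻ n (_∈ᶜ? family) (⊑-good (⊑-trans le (⊑-step a θ')) (gs i)) s≼ }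
        where
        same′ : ∀ i → type θ' n (ts i) ≡ type τ n (ms i)
        same′ i = trans (sym (le (gs i) n)) (proj₂ (proj₂ (realise {θ} (gs i))))
        same″ : ∀ i → type (step a θ') n (ts i) ≡ type τ n (ms i)
        same″ i = trans (sym (⊑-step a θ' (⊑-good le (gs i)) n)) (same′ i)
        to : SameAtoms (step a θ') u τ m
        to (inj₁ x) h = ∈-code⁻ (λ x → m ⊩? τ x) (proj₁ (step-bad⁻ θ' ¬g h))
        to (inj₂ p) h root = h root
        to (inj₂ p) h (child i s≼) = type-atoms n (same′ i) (inj₂ p) (λ r≼ → h (child i r≼)) s≼
        from : SameAtoms τ m (step a θ') u
        from (inj₁ x) h = step-in⁺ θ' (∈-code⁺ (λ x → m ⊩? τ x) h) λ
          { root g → ⊥-elim (¬g g)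
          ; (child i s≼) _ → ⊩-mono (θ' x) s≼
              (type-atoms n (sym (same′ i)) (inj₁ x) (⊩-mono (τ x) (child i root) h)) }
        from (inj₂ p) h root = h root
        from (inj₂ p) h (child i s≼) = type-atoms n (sym (same′ i)) (inj₂ p) (λ r≼ → h (child i r≼)) s≼
        same : type (step a θ') n u ≡ type τ n m
        same = type-root n to from (λ i → ms i , child i root , same″ i)
                                   (λ i → ts i , child i root , sym (same″ i))

    open Extension E extension

    unifies : ⊢ sub unifier B ⇔ E
    unifies = ∧I (completeness-⇒ (good⇒E {unifier})) (completeness-⇒ unifier-good)

    B⊢A : ⊢ B ⇒ A
    B⊢A = completeness-⇒ λ {t} g → good⇒A (subst (t ⊩_) (sym (sub-var B)) g)

    E⊢τB : ⊢ E ⇒ sub τ B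
    E⊢τB = completeness-⇒ λ e → within⁺ n (_∈ᶜ? family) {τ} λ s≼ →
      ∈-code⁺ realised? (realised⁺ (⊩-mono E s≼ e))

  -- The finite set of approximations

  module Approximants (Γ : List Fm) (A : Fm) where

    -- A single level for all of `Γ` and `A`, so that the candidates are fixed before any `E` and
    -- `τ` are given.
    n : ℕ
    n = foldr (λ X m → rank X ⊔ m) (rank A) Γ

    rank-A : rank A ≤ n
    rank-A = go Γ
      where
      go : ∀ Γ → rank A ≤ foldr (λ X m → rank X ⊔ m) (rank A) Γ
      go []      = ≤-refl
      go (X ∷ Γ) = ≤-trans (go Γ) (m≤n⊔m (rank X) _)

    rank-Γ : ∀ {E} → E ∈ Γ → rank E ≤ n
    rank-Γ = go
      where
      go : ∀ {Γ E} → E ∈ Γ → rank E ≤ foldr (λ X m → rank X ⊔ m) (rank A) Γ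
      go (here refl) = m≤m⊔n _ _
      go {X ∷ _} (there i) = ≤-trans (go i) (m≤n⊔m (rank X) _)

    open module Candidate (f : Fin (numTypes (suc n))) =
      Iterate n (_∈ᶜ? f) using (B; unifier; unifier-fixes)

    -- No `τ` occurs here: the projective substitution is computed from `f`, so validity reduces to
    -- derivability and is decidable.
    Valid : Fm × Fin (numTypes (suc n)) → Set
    Valid (E , f) = IsPar E × (⊢ B f ⇒ A) × (⊢ sub (unifier f) (B f) ⇔ E)

    valid? : Decidable Valid
    valid? (E , f) = isPar? E ×-dec ⊢? (B f ⇒ A) ×-dec ⊢? (sub (unifier f) (B f) ⇔ E)

    candidates : List (Fm × Fin (numTypes (suc n)))
    candidates = cartesianProduct Γ (allFin _)

    Π : List Fm
    Π = map (B ∘ proj₂) (filter valid? candidates)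

    ∈-Π⁻ : ∀ {X} → X ∈ Π → ∃ λ Ef → proj₁ Ef ∈ Γ × X ≡ B (proj₂ Ef) × Valid Ef
    ∈-Π⁻ X∈ =
      let Ef , Ef∈ , eq , valid = ∈-map∘filter⁻ (B ∘ proj₂) valid? {f = B ∘ proj₂} {xs = candidates} X∈
      in Ef , proj₁ (∈-cartesianProduct⁻ Γ (allFin _) Ef∈) , eq , valid

    projective : All (ΓProjective Γ) Π
    projective = All.tabulate λ X∈ → case ∈-Π⁻ X∈ of λ
      { ((E , f) , E∈ , refl , E-par , _ , unifies) →
          E , E∈ , E-par , unifier f , unifier-fixes f , unifies }

    ⋁-elim : ∀ {L} → All (λ X → ⊢ X ⇒ A) L → ⊢ ⋁ L ⇒ A
    ⋁-elim []       = ⇒I (⊥E (hyp (here refl)))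
    ⋁-elim (d ∷ ds) = ⇒I (∨E (hyp (here refl)) (apply d) (apply (⋁-elim ds)))
      where
      apply : ∀ {X Δ} → ⊢ X ⇒ A → X ∷ Δ ⊢ A
      apply d = ⇒E (weaken (λ ()) d) (hyp (here refl))

    Π⊢A : ⊢ ⋁ Π ⇒ A
    Π⊢A = ⋁-elim (All.tabulate λ X∈ → case ∈-Π⁻ X∈ of λ { (_ , _ , refl , _ , d , _) → d })

    -- The family of types that `τ` realises is one of the finitely many `f`, and `Approximation`
    -- shows that it passes the filter.
    entails : Entails Γ A Π
    entails E E∈ E-par τ E⊢τA = lose (∈-map∘filter⁺ (B ∘ proj₂) valid? {f = B ∘ proj₂} {xs = candidates}
        ((E , family) , ∈-cartesianProduct⁺ E∈ (∈-allFin family) , refl , E-par , B⊢A , unifies))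
      E⊢τB
      where open Approximation E E-par A τ E⊢τA n (rank-Γ E∈) rank-A

theorem5p6 : (nv np : ℕ) (Γ : List (Form nv np)) (A : Form nv np) →
    Σ (List (Form nv np)) λ Π →
    All (ΓProjective Γ) Π × (⊢ (⋁ Π ⇒ A)) × Entails Γ A Π
theorem5p6 nv np Γ A = Π , projective , Π⊢A , entails
  where open Projectivity.Approximants nv np Γ A
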